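{- Let $(W_r)_{r\in\mathbb{Z}}$ be a generalized Tribonacci sequence. For every integer $r$, \[ \begin{split} &W_r^3 - 4W_{r - 1}^3 - 9W_{r - 2}^3 - 34W_{r - 3}^3 + 24W_{r - 4}^3 - 2W_{r - 5}^3\\ &\quad + 40W_{r - 6}^3 - 14W_{r - 7}^3 - W_{r - 8}^3 - 2W_{r - 9}^3 + W_{r - 10}^3 = 0. \end{split} \]
   Context: Let $W_0,W_1,W_2$ be arbitrary integers, not all zero. The generalized Tribonacci numbers $(W_r)_{r\in\mathbb{Z}}$ are defined by $W_r=W_{r-1}+W_{r-2}+W_{r-3}$ for $r\ge 3$, and extended to negative indices by $W_{ -r}=W_{ -r+3}-W_{ -r+2}-W_{ -r+1}$ (so the recurrence holds for all $r\in\mathbb{Z}$). -}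

module Defs where

open import Data.Integer using (ℤ; _+_; _-_; _*_; +_; 0ℤ)
open import Data.Product using (_×_)
open import Relation.Binary.PropositionalEquality using (_≡_)
open import Relation.Nullary using (¬_)

-- W : ℤ → ℤ is a generalized Tribonacci sequence: the recurrence
-- W r = W (r-1) + W (r-2) + W (r-3) holds for every integer r
-- (this is exactly the forward recurrence plus the backward extension),
-- and the initial values W 0, W 1, W 2 are not all zero.
IsGenTribonacci : (ℤ → ℤ) → Set
IsGenTribonacci W =
  (∀ (r : ℤ) → W r ≡ W (r - + 1) + W (r - + 2) + W (r - + 3))
  × ¬ (W 0ℤ ≡ 0ℤ × W (+ 1) ≡ 0ℤ × W (+ 2) ≡ 0ℤ)

cube : ℤ → ℤ
cube x = x * x * x

{-# OPTIONS --safe #-}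
module Submission where

open import Defs
open import Data.Integer using (ℤ; _+_; _-_; _*_; +_; 0ℤ; -_)
open import Data.Integer.Properties using (+-assoc; neg-distrib-+)
open import Data.Integer.Solver using (module +-*-Solver)
import Data.Nat as ℕ
open import Data.Product using (_,_)
open import Relation.Binary.PropositionalEquality
  using (_≡_; refl; sym; trans; cong; cong₂)

-- Every term is an integer linear form in the three oldest, so the eleven cubes lie in the
-- 10-dimensional space of ternary cubic forms and must be linearly dependent. The coefficients come
-- from the polynomial whose roots are the products of three characteristic roots, repetition
-- allowed. `cube-relation` checks this dependence.

-- The recurrences are eliminated by matching on refl, so the identity becomes
-- a polynomial one in the three oldest terms w₈, w₉, w₁₀.
cube-relation : ∀ {w₀ w₁ w₂ w₃ w₄ w₅ w₆ w₇} w₈ w₉ w₁₀ →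
  w₇ ≡ w₈ + w₉ + w₁₀ → w₆ ≡ w₇ + w₈ + w₉ →
  w₅ ≡ w₆ + w₇ + w₈ → w₄ ≡ w₅ + w₆ + w₇ →
  w₃ ≡ w₄ + w₅ + w₆ → w₂ ≡ w₃ + w₄ + w₅ →
  w₁ ≡ w₂ + w₃ + w₄ → w₀ ≡ w₁ + w₂ + w₃ →
  cube w₀ - + 4 * cube w₁ - + 9 * cube w₂
    - + 34 * cube w₃ + + 24 * cube w₄
    - + 2 * cube w₅ + + 40 * cube w₆
    - + 14 * cube w₇ - cube w₈
    - + 2 * cube w₉ + cube w₁₀ ≡ 0ℤ
cube-relation w₈ w₉ w₁₀ refl refl refl refl refl refl refl refl =
  solve 3 (λ w₈ w₉ w₁₀ →
    -- Mirrors the substitutions forced by the `refl` patterns, so the polynomial evaluates to the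
    -- goal.
    let w₇ = w₈ :+ w₉ :+ w₁₀
        w₆ = w₇ :+ w₈ :+ w₉
        w₅ = w₆ :+ w₇ :+ w₈
        w₄ = w₅ :+ w₆ :+ w₇
        w₃ = w₄ :+ w₅ :+ w₆
        w₂ = w₃ :+ w₄ :+ w₅
        w₁ = w₂ :+ w₃ :+ w₄
        w₀ = w₁ :+ w₂ :+ w₃
    in :cube w₀ :- con (+ 4) :* :cube w₁ :- con (+ 9) :* :cube w₂
      :- con (+ 34) :* :cube w₃ :+ con (+ 24) :* :cube w₄
      :- con (+ 2) :* :cube w₅ :+ con (+ 40) :* :cube w₆
      :- con (+ 14) :* :cube w₇ :- :cube w₈
      :- con (+ 2) :* :cube w₉ :+ :cube w₁₀ := con 0ℤ)
    refl w₈ w₉ w₁₀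
  where
  open +-*-Solver
  :cube : ∀ {n} → Polynomial n → Polynomial n
  :cube p = p :* p :* p

-- Needed because nested shifts of a variable `r` do not merge by computation.
minus-minus : ∀ r m n → r - + m - + n ≡ r - + (m ℕ.+ n)
minus-minus r m n = trans (+-assoc r (- + m) (- + n))
  (cong (λ i → r + i) (sym (neg-distrib-+ (+ m) (+ n))))

theorem8 : (W : ℤ → ℤ) → IsGenTribonacci W → (r : ℤ) →
    cube (W r) - + 4 * cube (W (r - + 1)) - + 9 * cube (W (r - + 2))
    - + 34 * cube (W (r - + 3)) + + 24 * cube (W (r - + 4))
    - + 2 * cube (W (r - + 5)) + + 40 * cube (W (r - + 6))
    - + 14 * cube (W (r - + 7)) - cube (W (r - + 8))
    - + 2 * cube (W (r - + 9)) + cube (W (r - + 10)) ≡ 0ℤ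
theorem8 W (rec , _) r =
  cube-relation (W (r - + 8)) (W (r - + 9)) (W (r - + 10))
    -- On numerals the sums `k ℕ.+ j` compute, so the indices match. The last entry is `rec r`,
    -- since `r - + 0` does not reduce to `r`.
    (shift 7) (shift 6) (shift 5) (shift 4) (shift 3) (shift 2) (shift 1) (rec r)
  where
  shift : ∀ k → W (r - + k) ≡
    W (r - + (k ℕ.+ 1)) + W (r - + (k ℕ.+ 2)) + W (r - + (k ℕ.+ 3))
  shift k = trans (rec (r - + k))
    (cong₂ _+_ (cong₂ _+_ (step 1) (step 2)) (step 3))
    where
    step : ∀ j → W (r - + k - + j) ≡ W (r - + (k ℕ.+ j))
    step j = cong W (minus-minus r k j)
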